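{- Let $T$ be a tournament with at least five vertices that is $\Delta(1,2,2)$-free, $T_5$-free and $P_7^-$-free. Suppose there is a vertex $x\in V(T)$ such that $T\setminus x$ is a paving tournament and $x$ has at least two in-neighbours and at least two out-neighbours. Then $T$ is a paving tournament.
   Context: Tournaments are finite; $T\setminus x$ is $T$ with $x$ deleted; $T$ is $S$-free if no induced subtournament is isomorphic to $S$; $X\Rightarrow Y$ means all edges between disjoint $X,Y$ go from $X$ to $Y$. $\Delta(1,2,2)$: vertices $x,y_1,y_2,z_1,z_2$ with $x\Rightarrow\{y_1,y_2\}\Rightarrow\{z_1,z_2\}\Rightarrow x$ and edges $y_1y_2,z_1z_2$. $T_5$: vertices $v_1,\dots,v_5$, $v_iv_j\in E$ iff $j-i\equiv1,2\pmod5$. $P_7^-$: obtained by deleting one vertex from $P_7$, the tournament on $v_1,\dots,v_7$ with $v_iv_j\in E$ iff $j-i\equiv1,2,4\pmod7$. For an ordering $\sigma=(v_1,\dots,v_n)$, the backedge graph $B_\sigma(T)$ is the undirected graph on $V(T)$ with edges $v_iv_j$ for $i>j$ and $v_iv_j\in E(T)$. $T$ is a paving tournament if some ordering $\sigma=(v_1,\dots,v_n)$ satisfies: $v_i,v_{i+1}$ are nonadjacent in $B_\sigma(T)$ for each $i\in[n-1]$, and each $v_i$ has at most one $B_\sigma(T)$-neighbour in $\{v_s:s<i\}$ and at most one in $\{v_t:t>i\}$. -}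

module Defs where

open import Data.Bool using (Bool; true; false)
open import Data.Nat using (ℕ; _+_; _∸_; _%_)
import Data.Nat as N
open import Data.Fin using (Fin; zero; suc; toℕ; _<_; _>_; punchIn)
import Data.Fin
open import Data.Fin.Permutation using (Permutation′; _⟨$⟩ʳ_)
open import Data.Product using (Σ; ∃; _×_; _,_)
open import Data.Sum using (_⊎_)
open import Function.Definitions using (Injective)
open import Relation.Binary.PropositionalEquality using (_≡_; _≢_)
open import Relation.Nullary using (¬_)

-- A digraph on vertex set Fin n, given by a Boolean adjacency matrix:
-- adj u v ≡ true  means  uv ∈ E (edge directed from u to v).
Adj : ℕ → Set
Adj n = Fin n → Fin n → Bool

record IsTournament {n : ℕ} (adj : Adj n) : Set where
  field
    irrefl  : ∀ u → adj u u ≡ false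
    total   : ∀ u v → u ≢ v → adj u v ≡ true ⊎ adj v u ≡ true
    antisym : ∀ u v → adj u v ≡ true → adj v u ≡ false

delete : ∀ {n} → Adj (N.suc n) → Fin (N.suc n) → Adj n
delete adj x u v = adj (punchIn x u) (punchIn x v)

_Embeds-in_ : ∀ {m n} → Adj m → Adj n → Set
_Embeds-in_ {m} {n} S T =
  Σ (Fin m → Fin n) λ f → Injective _≡_ _≡_ f × (∀ i j → S i j ≡ T (f i) (f j))

Free : ∀ {m n} → Adj m → Adj n → Set
Free S T = ¬ (S Embeds-in T)

-- Δ(1,2,2): x=0, y1=1, y2=2, z1=3, z2=4 with
-- x ⇒ {y1,y2} ⇒ {z1,z2} ⇒ x, and edges y1y2, z1z2.
Δ122 : Adj 5
Δ122 zero (suc zero) = true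
Δ122 zero (suc (suc zero)) = true
Δ122 (suc zero) (suc (suc zero)) = true
Δ122 (suc zero) (suc (suc (suc zero))) = true
Δ122 (suc zero) (suc (suc (suc (suc zero)))) = true
Δ122 (suc (suc zero)) (suc (suc (suc zero))) = true
Δ122 (suc (suc zero)) (suc (suc (suc (suc zero)))) = true
Δ122 (suc (suc (suc zero))) zero = true
Δ122 (suc (suc (suc zero))) (suc (suc (suc (suc zero)))) = true
Δ122 (suc (suc (suc (suc zero)))) zero = true
Δ122 _ _ = false

T5 : Adj 5
T5 i j with (toℕ j + 5 ∸ toℕ i) % 5
... | 1 = true
... | 2 = true
... | _ = false

P7 : Adj 7
P7 i j with (toℕ j + 7 ∸ toℕ i) % 7
... | 1 = true
... | 2 = true
... | 4 = true
... | _ = false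

-- P7⁻: P7 with one vertex (the last one, index 6) deleted.
-- (P7 is vertex-transitive, so the choice of deleted vertex is irrelevant.)
P7⁻ : Adj 6
P7⁻ = delete P7 (Data.Fin.fromℕ 6)

-- Backedge graph of T with respect to the ordering σ (position p holds
-- vertex σ p), expressed on positions: positions p, q are adjacent iff
-- the later one has an edge of T to the earlier one.
Backedge : ∀ {n} → Adj n → Permutation′ n → Fin n → Fin n → Set
Backedge adj σ p q =
    (p > q × adj (σ ⟨$⟩ʳ p) (σ ⟨$⟩ʳ q) ≡ true)
  ⊎ (q > p × adj (σ ⟨$⟩ʳ q) (σ ⟨$⟩ʳ p) ≡ true)

IsPavingOrdering : ∀ {n} → Adj n → Permutation′ n → Set
IsPavingOrdering {n} adj σ =
    (∀ (p q : Fin n) → toℕ q ≡ N.suc (toℕ p) → ¬ Backedge adj σ p q)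
  × (∀ (p q r : Fin n) → q < p → r < p →
       Backedge adj σ p q → Backedge adj σ p r → q ≡ r)
  × (∀ (p q r : Fin n) → p < q → p < r →
       Backedge adj σ p q → Backedge adj σ p r → q ≡ r)

Paving : ∀ {n} → Adj n → Set
Paving {n} adj = ∃ λ (σ : Permutation′ n) → IsPavingOrdering adj σ

{-# OPTIONS --safe #-}
module Submission where

-- Call an order of the vertices sparse if every vertex has at most one backedge
-- to each side.  A tournament with a sparse order is paving: exchanging two
-- consecutive vertices joined by a backedge removes that backedge and creates none.
-- So take a sparse order of T \ x and try to put x into it.  Among the sparse orders
-- choose one with the fewest inversions, an inversion being an out-neighbour of x
-- placed before an in-neighbour of x.  If x still does not fit, then the inversions
-- that cannot be removed by exchanging or rotating two or three consecutive vertices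
-- force a configuration of at most five vertices which, together with x, contains
-- Δ(1,2,2), T₅ or P₇⁻; these finitely many configurations are checked by computation.

open import Defs
open import Data.Bool using (Bool; true; false; not; _∧_; _∨_; T; T?)
open import Data.Bool.ListAction using (any; all)
open import Data.Bool.Properties using (T-≡; T-∧; T-∨) renaming (_≟_ to _≟ᵇ_)
open import Data.Empty using (⊥)
open import Data.Fin as Fin using (Fin; zero; suc; toℕ; fromℕ<; punchIn; punchOut)
open import Data.Fin.Induction using (spo-wellFounded)
open import Data.Fin.Patterns
open import Data.Fin.Permutation using (Permutation′; permutation; _⟨$⟩ʳ_; _⟨$⟩ˡ_; inverseˡ; inverseʳ)
open import Data.Fin.Permutation.Components using (transpose; transpose-inverse)
open import Data.Fin.Properties using (_≟_; any?; all?; toℕ-fromℕ<; injective⇒≤; <-cmp; <-isStrictTotalOrder)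
open import Data.Fin.Properties using (punchInᵢ≢i; punchIn-injective; punchIn-punchOut; punchOut-injective)
open import Data.List using (List; []; _∷_; length; filter; allFin; cartesianProduct; map; concatMap; filterᵇ)
open import Data.List.Membership.Propositional using (_∈_)
open import Data.List.Membership.Propositional.Properties using (∈-filter⁺; ∈-filter⁻; ∈-allFin; ∈-cartesianProduct⁺)
open import Data.List.Properties using (length-tabulate; filter-all)
open import Data.List.Relation.Binary.Pointwise using (Pointwise-≡⇒≡)
open import Data.List.Relation.Binary.Sublist.Propositional using (⊆-refl)
open import Data.List.Relation.Binary.Sublist.Propositional.Properties using (filter⁺; length-mono-≤; to-≋)
open import Data.List.Relation.Unary.All as All using (All; []; _∷_)
open import Data.List.Relation.Unary.All.Properties using (all⁻)
open import Data.List.Relation.Unary.Any using (satisfied)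
open import Data.List.Relation.Unary.Any.Properties using (any⁻)
open import Data.Maybe using (Maybe; just; nothing)
open import Data.Nat using (ℕ; suc; _<_; _≤_; zero; z<s; _≥_)
open import Data.Nat.Induction using (<-wellFounded)
open import Data.Nat.Properties using (≤∧≢⇒<; n<1+n; <-≤-trans; <-irrefl; <-asym; 1+n≰n) renaming (<-trans to <ⁿ-trans)
open import Data.Product using (Σ; ∃; _×_; _,_; proj₁; proj₂; uncurry)
open import Data.Sum using (_⊎_; inj₁; inj₂; [_,_]′)
open import Data.Unit using (tt)
open import Data.Vec using (Vec; []; _∷_; lookup)
open import Data.Vec.Relation.Unary.Linked as Linked using (Linked; []; [-]; _∷_)
open import Data.Vec.Relation.Unary.Linked.Properties using (lookup⁺)
open import Function using (_∘_; Injective; Equivalence)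
open import Induction.WellFounded using (Acc; acc)
open import Relation.Binary using (IsStrictTotalOrder; Decidable; Tri; tri<; tri≈; tri>)
import Relation.Binary.Construct.Flip.EqAndOrd as Flip
open import Relation.Binary.PropositionalEquality using (_≡_; _≢_; refl; sym; trans; cong; cong₂; subst; subst₂; isEquivalence)
open import Relation.Binary.Structures.Biased using (isStrictTotalOrderᶜ)
open import Relation.Nullary using (¬_; Dec; yes; no; contradiction; does; isYes)
open import Relation.Nullary.Decidable using (_×-dec_; _⊎-dec_; _→-dec_; ¬?; True; toWitness; map′; dec-true)
open import Relation.Unary using () renaming (Decidable to Decidable₁)

-- Linear orders.

record LinearOrder (A : Set) : Set₁ where
  infix 4 _≺_
  field
    _≺_                : A → A → Set
    isStrictTotalOrder : IsStrictTotalOrder _≡_ _≺_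

  open IsStrictTotalOrder isStrictTotalOrder public
    using (compare; irrefl; asym; isStrictPartialOrder)
    renaming (trans to ≺-trans; _<?_ to _≺?_)

  Adjacent : A → A → Set
  Adjacent u v = u ≺ v × (∀ w → u ≺ w → w ≺ v → ⊥)

  ≺⇒≢ : ∀ {u v} → u ≺ v → u ≢ v
  ≺⇒≢ u≺v refl = irrefl refl u≺v

  ⊀⇒≻ : ∀ {u v} → u ≢ v → ¬ (u ≺ v) → v ≺ u
  ⊀⇒≻ {u} {v} u≢v u⊀v with compare u v
  ... | tri< u≺v _ _ = contradiction u≺v u⊀v
  ... | tri≈ _ u≡v _ = contradiction u≡v u≢v
  ... | tri> _ _ v≺u = v≺u

  ≺-≼-trans : ∀ {u v w} → u ≺ v → ¬ (w ≺ v) → u ≺ w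
  ≺-≼-trans {u} {v} {w} u≺v w⊀v with compare v w
  ... | tri< v≺w _ _ = ≺-trans u≺v v≺w
  ... | tri≈ _ refl _ = u≺v
  ... | tri> _ _ w≺v = contradiction w≺v w⊀v

  ≼-≺-trans : ∀ {u v w} → ¬ (v ≺ u) → v ≺ w → u ≺ w
  ≼-≺-trans {u} {v} {w} v⊀u v≺w with compare u v
  ... | tri< u≺v _ _ = ≺-trans u≺v v≺w
  ... | tri≈ _ refl _ = v≺w
  ... | tri> _ _ v≺u = contradiction v≺u v⊀u

open LinearOrder hiding (_≺_)

infix 4 _≺[_]_
_≺[_]_ : {A : Set} → A → LinearOrder A → A → Set
u ≺[ O ] v = LinearOrder._≺_ O u v

pullback : {A B : Set} (f : A → B) → Injective _≡_ _≡_ f → LinearOrder B → LinearOrder A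
pullback f f-injective O = record
  { _≺_ = λ u v → f u ≺[ O ] f v
  ; isStrictTotalOrder = isStrictTotalOrderᶜ record
    { isEquivalence = isEquivalence ; trans = ≺-trans O ; compare = compare′ }
  }
  where
  compare′ : ∀ u v → Tri (f u ≺[ O ] f v) (u ≡ v) (f v ≺[ O ] f u)
  compare′ u v with compare O (f u) (f v)
  ... | tri< lt ≢ ≯ = tri< lt (≢ ∘ cong f) ≯
  ... | tri≈ ≮ ≡ ≯ = tri≈ ≮ (f-injective ≡) ≯
  ... | tri> ≮ ≢ gt = tri> ≮ (≢ ∘ cong f) gt

flip : {A : Set} → LinearOrder A → LinearOrder A
flip O = record
  { _≺_ = λ u v → v ≺[ O ] u
  ; isStrictTotalOrder = Flip.isStrictTotalOrder (isStrictTotalOrder O)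
  }

flip-adjacent : ∀ {A} {O : LinearOrder A} {u v} → Adjacent O u v → Adjacent (flip O) v u
flip-adjacent (u≺v , between) = u≺v , λ w w≺v u≺w → between w u≺w w≺v

-- Extremal elements, counting and enumeration in finite orders.

minimum : ∀ {n} (O : LinearOrder (Fin n)) {P : Fin n → Set} → Decidable₁ P → ∃ P →
          ∃ λ m → P m × (∀ u → P u → ¬ (u ≺[ O ] m))
minimum O {P} P? (v , Pv) = go v Pv (spo-wellFounded (isStrictPartialOrder O) v)
  where
  go : ∀ v → P v → Acc (LinearOrder._≺_ O) v → ∃ λ m → P m × (∀ u → P u → ¬ (u ≺[ O ] m))
  go v Pv (acc rec) with any? (λ u → P? u ×-dec _≺?_ O u v)
  ... | yes (u , Pu , u≺v) = go u Pu (rec u≺v)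
  ... | no ¬below = v , Pv , λ u Pu u≺v → ¬below (u , Pu , u≺v)

maximum : ∀ {n} (O : LinearOrder (Fin n)) {P : Fin n → Set} → Decidable₁ P → ∃ P →
          ∃ λ m → P m × (∀ u → P u → ¬ (m ≺[ O ] u))
maximum O = minimum (flip O)

-- The first filtered list is a sublist of the second. Equal lengths would make the two lists equal,
-- and then `x` would satisfy `P`.
filter-strict : {A : Set} {P Q : A → Set} (P? : Decidable₁ P) (Q? : Decidable₁ Q) →
                (∀ {x} → P x → Q x) → ∀ {x xs} → x ∈ xs → Q x → ¬ P x →
                length (filter P? xs) < length (filter Q? xs)
filter-strict P? Q? P⊆Q {x} {xs} x∈xs Qx ¬Px =
  ≤∧≢⇒< (length-mono-≤ sub) λ eq → ¬Px (proj₂ (∈-filter⁻ P? {xs = xs}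
    (subst (x ∈_) (sym (Pointwise-≡⇒≡ (to-≋ eq sub))) (∈-filter⁺ Q? x∈xs Qx))))
  where sub = filter⁺ P? Q? (λ { refl → P⊆Q }) (⊆-refl {x = xs})

-- The termination measure of both descents: over backedges in `sparse⇒paving`, over inversions in
-- `frame⇒paving`.
count : ∀ {n} {R : Fin n → Fin n → Set} → Decidable R → ℕ
count {n} R? = length (filter (uncurry R?) (cartesianProduct (allFin n) (allFin n)))

count-strict : ∀ {n} {R S : Fin n → Fin n → Set} (R? : Decidable R) (S? : Decidable S) →
               (∀ {u v} → R u v → S u v) → ∀ {a b} → S a b → ¬ R a b → count R? < count S?
count-strict R? S? R⊆S {a} {b} Sab ¬Rab =
  filter-strict (uncurry R?) (uncurry S?) R⊆S (∈-cartesianProduct⁺ (∈-allFin a) (∈-allFin b)) Sab ¬Rab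

-- Punching out a missed value would give an injection into a smaller set.
injective⇒surjective : ∀ {n} {f : Fin n → Fin n} → Injective _≡_ _≡_ f → ∀ y → ∃ λ x → f x ≡ y
injective⇒surjective {suc n} {f} f-injective y with any? (λ x → f x ≟ y)
... | yes hit = hit
... | no miss = contradiction (injective⇒≤ (λ {u} {v} eq → f-injective (punchOut-injective (≢y u) (≢y v) eq))) 1+n≰n
  where
  ≢y : ∀ x → y ≢ f x
  ≢y x y≡fx = miss (x , sym y≡fx)

-- The position of a vertex is the number of vertices below it. Positions are strictly monotone,
-- hence injective, hence a bijection; its inverse lists the vertices in order.
enumerate : ∀ {n} (O : LinearOrder (Fin n)) →
            ∃ λ (σ : Permutation′ n) → ∀ p q → p Fin.< q → σ ⟨$⟩ʳ p ≺[ O ] σ ⟨$⟩ʳ q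
enumerate {n} O = permutation at position (λ v → position-injective (position∘at (position v))) position∘at , at-monotone
  where
  below : Fin n → ℕ
  below v = length (filter (λ u → _≺?_ O u v) (allFin n))

  below<n : ∀ v → below v < n
  -- The constantly true filter keeps all `n` vertices, while `v` is not below itself.
  below<n v = subst (below v <_)
    (trans (cong length (filter-all (λ _ → yes tt) (All.universal (λ _ → tt) (allFin n)))) (length-tabulate {n = n} (λ i → i)))
    (filter-strict (λ u → _≺?_ O u v) (λ _ → yes tt) (λ _ → tt) (∈-allFin v) tt (irrefl O refl))

  position : Fin n → Fin n
  position v = fromℕ< (below<n v)

  position-monotone : ∀ {u v} → u ≺[ O ] v → position u Fin.< position v
  position-monotone {u} {v} u≺v = subst₂ _<_ (sym (toℕ-fromℕ< (below<n u))) (sym (toℕ-fromℕ< (below<n v)))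
    (filter-strict (λ w → _≺?_ O w u) (λ w → _≺?_ O w v) (λ w≺u → ≺-trans O w≺u u≺v) (∈-allFin u) u≺v (irrefl O refl))

  position-injective : Injective _≡_ _≡_ position
  position-injective {u} {v} eq with compare O u v
  ... | tri< u≺v _ _ = contradiction (position-monotone u≺v) (<-irrefl (cong toℕ eq))
  ... | tri≈ _ u≡v _ = u≡v
  ... | tri> _ _ v≺u = contradiction (position-monotone v≺u) (<-irrefl (cong toℕ (sym eq)))

  at : Fin n → Fin n
  at p = proj₁ (injective⇒surjective position-injective p)

  position∘at : ∀ p → position (at p) ≡ p
  position∘at p = proj₂ (injective⇒surjective position-injective p)

  at-monotone : ∀ p q → p Fin.< q → at p ≺[ O ] at q
  at-monotone p q p<q with compare O (at p) (at q)
  ... | tri< lt _ _ = lt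
  ... | tri≈ _ eq _ = contradiction p<q (<-irrefl (cong toℕ (trans (sym (position∘at p)) (trans (cong position eq) (position∘at q)))))
  ... | tri> _ _ gt = contradiction (<ⁿ-trans p<q (subst₂ Fin._<_ (position∘at q) (position∘at p) (position-monotone gt))) (<-irrefl refl)

-- Sparse orders and exchanges of consecutive vertices.

Back : {A : Set} → LinearOrder A → (A → A → Bool) → A → A → Set
Back O E u v = u ≺[ O ] v × E v u ≡ true

back? : ∀ {A} (O : LinearOrder A) E → Decidable (Back O E)
back? O E u v = _≺?_ O u v ×-dec (E v u ≟ᵇ true)

-- The degree conditions of a paving ordering. Consecutive vertices may be joined by a backedge,
-- since the rotations pass through such orders.
record Sparse {A : Set} (O : LinearOrder A) (E : A → A → Bool) : Set where
  field
    left-unique  : ∀ {u v w} → Back O E u w → Back O E v w → u ≡ v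
    right-unique : ∀ {u v w} → Back O E u v → Back O E u w → v ≡ w

open Sparse

-- The two situations in which exchanging `a` and `b` keeps an order sparse: either a backedge
-- disappears, or a new one may arise between them, for which `a` has room on its left and `b` on
-- its right.
Movable : {A : Set} → LinearOrder A → (A → A → Bool) → A → A → Set
Movable O E a b = Adjacent O a b ×
  (Back O E a b ⊎ (¬ (∃ λ l → Back O E l a)) × (¬ (∃ λ r → Back O E b r)))

adjacent? : ∀ {n} (O : LinearOrder (Fin n)) → Decidable (Adjacent O)
adjacent? O u v = _≺?_ O u v ×-dec all? λ w → _≺?_ O u w →-dec (_≺?_ O w v →-dec no λ ())

movable? : ∀ {n} (O : LinearOrder (Fin n)) E → Decidable (Movable O E)
movable? O E a b = adjacent? O a b ×-dec
  (back? O E a b ⊎-dec (¬? (any? λ l → back? O E l a) ×-dec ¬? (any? λ r → back? O E b r)))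

-- A view of `transpose`, indexed by its value so that matching on it also replaces that value.
data Transposed {n} (a b u : Fin n) : Fin n → Set where
  fst   : u ≡ a → Transposed a b u b
  snd   : u ≡ b → Transposed a b u a
  other : u ≢ a → u ≢ b → Transposed a b u u

transposed : ∀ {n} (a b u : Fin n) → Transposed a b u (transpose a b u)
transposed a b u with u ≟ a
... | yes u≡a = fst u≡a
... | no u≢a with u ≟ b
...   | yes u≡b = snd u≡b
...   | no u≢b = other u≢a u≢b

transpose-injective : ∀ {n} (a b : Fin n) → Injective _≡_ _≡_ (transpose a b)
transpose-injective a b eq =
  trans (sym (transpose-inverse b a)) (trans (cong (transpose b a) eq) (transpose-inverse b a))

-- Pulling the order back along the transposition exchanges two places and leaves the names of the
-- vertices and the edges alone.
swap : ∀ {n} → Fin n → Fin n → LinearOrder (Fin n) → LinearOrder (Fin n)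
swap a b = pullback (transpose a b) (transpose-injective a b)

module _ {n} (O : LinearOrder (Fin n)) {a b : Fin n} (a⋖b : Adjacent O a b) where
  private
    a≺b = proj₁ a⋖b

  -- No vertex lies between `a` and `b`, so comparisons with a third vertex are unaffected and only
  -- the pair itself turns round.
  swap-≺ : ∀ {u v} → u ≺[ swap a b O ] v → u ≺[ O ] v ⊎ (u ≡ b × v ≡ a)
  swap-≺ {u} {v} u≺v with transpose a b u | transpose a b v | transposed a b u | transposed a b v
  ... | _ | _ | fst refl | fst refl = contradiction u≺v (irrefl O refl)
  ... | _ | _ | fst refl | snd refl = inj₁ a≺b
  ... | _ | _ | fst refl | other _ _ = inj₁ (≺-trans O a≺b u≺v)
  ... | _ | _ | snd refl | fst refl = inj₂ (refl , refl)
  ... | _ | _ | snd refl | snd refl = contradiction u≺v (irrefl O refl)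
  ... | _ | _ | snd refl | other _ v≢b = inj₁ (⊀⇒≻ O v≢b (proj₂ a⋖b _ u≺v))
  ... | _ | _ | other u≢a _ | fst refl = inj₁ (⊀⇒≻ O (u≢a ∘ sym) (λ a≺u → proj₂ a⋖b _ a≺u u≺v))
  ... | _ | _ | other _ _ | snd refl = inj₁ (≺-trans O u≺v a≺b)
  ... | _ | _ | other _ _ | other _ _ = inj₁ u≺v

  swapped : b ≺[ swap a b O ] a
  swapped with transpose a b a | transpose a b b | transposed a b a | transposed a b b
  ... | _ | _ | fst _ | snd _ = a≺b
  ... | _ | _ | fst _ | fst b≡a = contradiction (sym b≡a) (≺⇒≢ O a≺b)
  ... | _ | _ | fst _ | other _ b≢b = contradiction refl b≢b
  ... | _ | _ | snd a≡b | _ = contradiction a≡b (≺⇒≢ O a≺b)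
  ... | _ | _ | other a≢a _ | _ = contradiction refl a≢a

  module _ {E : Adj n} where

    swap-back : ∀ {u v} → Back (swap a b O) E u v → Back O E u v ⊎ (u ≡ b × v ≡ a × E a b ≡ true)
    swap-back (u≺v , Evu) with swap-≺ u≺v
    ... | inj₁ u≺v = inj₁ (u≺v , Evu)
    ... | inj₂ (refl , refl) = inj₂ (refl , refl , Evu)

    swap-back-⊆ : (E b a ≡ true → E a b ≡ false) → Back O E a b →
                  ∀ {u v} → Back (swap a b O) E u v → Back O E u v
    swap-back-⊆ antisym (_ , Eba) back with swap-back back
    ... | inj₁ back = back
    ... | inj₂ (_ , _ , Eab) with () ← trans (sym Eab) (antisym Eba)

    swap-sparse : (E b a ≡ true → E a b ≡ false) → Sparse O E → Movable O E a b → Sparse (swap a b O) E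
    swap-sparse antisym sparse (_ , inj₁ back) = record
      { left-unique = λ p q → left-unique sparse (⊆ p) (⊆ q)
      ; right-unique = λ p q → right-unique sparse (⊆ p) (⊆ q)
      }
      where
      ⊆ : ∀ {u v} → Back (swap a b O) E u v → Back O E u v
      ⊆ = swap-back-⊆ antisym back
    swap-sparse _ sparse (_ , inj₂ (¬l , ¬r)) = record { left-unique = left ; right-unique = right }
      where
      left : ∀ {u v w} → Back (swap a b O) E u w → Back (swap a b O) E v w → u ≡ v
      left p q with swap-back p | swap-back q
      ... | inj₁ p | inj₁ q = left-unique sparse p q
      ... | inj₁ p | inj₂ (_ , refl , _) = contradiction (_ , p) ¬l
      ... | inj₂ (_ , refl , _) | inj₁ q = contradiction (_ , q) ¬l
      ... | inj₂ (refl , _) | inj₂ (refl , _) = refl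

      right : ∀ {u v w} → Back (swap a b O) E u v → Back (swap a b O) E u w → v ≡ w
      right p q with swap-back p | swap-back q
      ... | inj₁ p | inj₁ q = right-unique sparse p q
      ... | inj₁ p | inj₂ (refl , _) = contradiction (_ , p) ¬r
      ... | inj₂ (refl , _) | inj₁ q = contradiction (_ , q) ¬r
      ... | inj₂ (_ , refl , _) | inj₂ (_ , refl , _) = refl

-- Recursion on the number of backedges. Once no consecutive pair is joined by one, the enumeration
-- of the order is a paving ordering.
sparse⇒paving : ∀ {n} {E : Adj n} → IsTournament E → (O : LinearOrder (Fin n)) → Sparse O E → Paving E
sparse⇒paving {n} {E} tournament O sparse = go O sparse (<-wellFounded _)
  where
  go : (O : LinearOrder (Fin n)) → Sparse O E → Acc _<_ (count (back? O E)) → Paving E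
  go O sparse (acc rec) with any? (λ a → any? (λ b → adjacent? O a b ×-dec back? O E a b))
  ... | yes (a , b , a⋖b , back) = go (swap a b O)
          (swap-sparse O a⋖b antisym sparse (a⋖b , inj₁ back))
          (rec (count-strict (back? (swap a b O) E) (back? O E) (swap-back-⊆ O a⋖b antisym back) back
            λ (a≺b , _) → asym (swap a b O) {a} {b} a≺b (swapped O a⋖b)))
    where antisym = IsTournament.antisym tournament b a
  ... | no ¬adjacent = σ , consecutive , lefts , rights
    where
    σ = proj₁ (enumerate O)

    σ-monotone : ∀ {p q} → p Fin.< q → σ ⟨$⟩ʳ p ≺[ O ] σ ⟨$⟩ʳ q
    σ-monotone = proj₂ (enumerate O) _ _

    σ-injective : Injective _≡_ _≡_ (σ ⟨$⟩ʳ_)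
    σ-injective eq = trans (sym (inverseˡ σ)) (trans (cong (σ ⟨$⟩ˡ_) eq) (inverseˡ σ))

    σ-reflects : ∀ {p q} → σ ⟨$⟩ʳ p ≺[ O ] σ ⟨$⟩ʳ q → p Fin.< q
    σ-reflects {p} {q} lt with <-cmp p q
    ... | tri< p<q _ _ = p<q
    ... | tri≈ _ refl _ = contradiction lt (irrefl O refl)
    ... | tri> _ _ q<p = contradiction (σ-monotone q<p) (asym O lt)

    back : ∀ {p q} → p Fin.< q → Backedge E σ q p → Back O E (σ ⟨$⟩ʳ p) (σ ⟨$⟩ʳ q)
    back p<q (inj₁ (_ , e)) = σ-monotone p<q , e
    back p<q (inj₂ (q<p , _)) = contradiction q<p (<-asym p<q)

    back′ : ∀ {p q} → p Fin.< q → Backedge E σ p q → Back O E (σ ⟨$⟩ʳ p) (σ ⟨$⟩ʳ q)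
    back′ p<q = back p<q ∘ [ inj₂ , inj₁ ]′

    consecutive : ∀ p q → toℕ q ≡ suc (toℕ p) → ¬ Backedge E σ p q
    consecutive p q q≡1+p e = ¬adjacent (_ , _ , (σ-monotone p<q , between) , back′ p<q e)
      where
      p<q : p Fin.< q
      p<q = subst (toℕ p <_) (sym q≡1+p) (n<1+n _)

      between : ∀ w → σ ⟨$⟩ʳ p ≺[ O ] w → w ≺[ O ] σ ⟨$⟩ʳ q → ⊥
      -- The position of `w` would lie strictly between two successive numbers.
      between w p≺w w≺q = <-irrefl refl (<-≤-trans (σ-reflects (subst (λ v → v ≺[ O ] _) (sym (inverseʳ σ)) w≺q))
        (subst (_≤ toℕ (σ ⟨$⟩ˡ w)) (sym q≡1+p) (σ-reflects (subst (LinearOrder._≺_ O _) (sym (inverseʳ σ)) p≺w))))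

    lefts : ∀ p q r → q Fin.< p → r Fin.< p → Backedge E σ p q → Backedge E σ p r → q ≡ r
    lefts p q r q<p r<p e f = σ-injective (left-unique sparse (back q<p e) (back r<p f))

    rights : ∀ p q r → p Fin.< q → p Fin.< r → Backedge E σ p q → Backedge E σ p r → q ≡ r
    rights p q r p<q p<r e f = σ-injective (right-unique sparse (back′ p<q e) (back′ p<r f))

-- The tournament with a sparse order of all vertices but `x`.

complement : ∀ {n} {E : Adj n} → IsTournament E → ∀ {u v} → u ≢ v → E u v ≡ not (E v u)
complement {E = E} tournament {u} {v} u≢v with E v u in Evu
... | true = IsTournament.antisym tournament v u Evu
... | false with IsTournament.total tournament u v u≢v
...   | inj₁ Euv = Euv
...   | inj₂ Evu′ with () ← trans (sym Evu) Evu′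

-- The state of the descent. Exchanges alter only `order` and `sparse`; bundling everything lets
-- reversal act on the whole situation at once.
record Frame (n : ℕ) : Set₁ where
  field
    tour       : Adj (suc n)
    tournament : IsTournament tour
    Δ122-free  : Free Δ122 tour
    T5-free    : Free T5 tour
    P7⁻-free   : Free P7⁻ tour
    x          : Fin (suc n)
    order      : LinearOrder (Fin n)
    sparse     : Sparse order (delete tour x)

  open LinearOrder order public using () renaming (_≺_ to infix 4 _≺_; Adjacent to infix 4 _⋖_)

  E : Adj n
  E = delete tour x

  Out In : Fin n → Set
  Out v = tour x (punchIn x v) ≡ true
  In  v = tour (punchIn x v) x ≡ true

  infix 4 _↩_
  _↩_ : Fin n → Fin n → Set
  _↩_ = Back order E

-- Finite configurations and their exhaustive check.

-- A sparse order of k vertices together with their adjacency to a further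
-- vertex x: for each vertex, from first to last, whether x dominates it and
-- which later vertex (if any) has a backedge to it.
data Code : ℕ → Set where
  []     : Code 0
  vertex : ∀ {k} → Bool → Maybe (Fin k) → Code k → Code (suc k)

_is_ : ∀ {k} → Maybe (Fin k) → Fin k → Bool
nothing is j = false
just i  is j = does (i ≟ j)

dominated : ∀ {k} → Code k → Fin k → Bool
dominated (vertex s _ c) zero    = s
dominated (vertex _ _ c) (suc i) = dominated c i

edge : ∀ {k} → Code k → Adj k
edge (vertex _ r c) zero    zero    = false
edge (vertex _ r c) zero    (suc j) = not (r is j)
edge (vertex _ r c) (suc i) zero    = r is i
edge (vertex _ r c) (suc i) (suc j) = edge c i j

adjacency : ∀ {k} → Code k → Adj (suc k)
adjacency c zero    zero    = false
adjacency c zero    (suc j) = dominated c j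
adjacency c (suc i) zero    = not (dominated c i)
adjacency c (suc i) (suc j) = edge c i j

hasLeft : ∀ {k} → Code k → Fin k → Bool
hasLeft (vertex _ _ c) zero    = false
hasLeft (vertex _ r c) (suc j) = (r is j) ∨ hasLeft c j

fresh : ∀ {k} → Maybe (Fin k) → Code k → Bool
fresh nothing  c = true
fresh (just j) c = not (hasLeft c j)

-- The type `Code` already limits each vertex to one backedge on its right; the limit on the left
-- has to be tested.
valid : ∀ {k} → Code k → Bool
valid []             = true
valid (vertex _ r c) = fresh r c ∧ valid c

infix 4 _==_
_==_ : Bool → Bool → Bool
a == b = does (a ≟ᵇ b)

-- Only a search: isEmbedding? checks the candidates again.
embeddings : ∀ {m k} → Adj m → Adj k → List (Vec (Fin k) m)
embeddings {zero}  {k} S M = [] ∷ []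
embeddings {suc m} {k} S M =
  concatMap (λ f → map (_∷ f) (filterᵇ (extends f) (allFin k))) (embeddings (λ i j → S (suc i) (suc j)) M)
  where
  extends : Vec (Fin k) m → Fin k → Bool
  extends f v = all (λ i → (S zero (suc i) == M v (lookup f i)) ∧ (S (suc i) zero == M (lookup f i) v)) (allFin m)

IsEmbedding : ∀ {m k} → Adj m → Adj k → Vec (Fin k) m → Set
IsEmbedding S M f = (∀ i j → lookup f i ≡ lookup f j → i ≡ j) × (∀ i j → S i j ≡ M (lookup f i) (lookup f j))

isEmbedding? : ∀ {m k} (S : Adj m) (M : Adj k) f → Dec (IsEmbedding S M f)
isEmbedding? S M f =
  all? (λ i → all? λ j → (lookup f i ≟ lookup f j) →-dec (i ≟ j)) ×-dec
  all? (λ i → all? λ j → S i j ≟ᵇ M (lookup f i) (lookup f j))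

contains : ∀ {m k} → Adj m → Adj k → Bool
contains S M = any (λ f → isYes (isEmbedding? S M f)) (embeddings S M)

contains-sound : ∀ {m k} (S : Adj m) (M : Adj k) → T (contains S M) → S Embeds-in M
contains-sound S M p with satisfied (any⁻ _ (embeddings S M) p)
... | f , q = lookup f , (λ {i} {j} → proj₁ emb i j) , proj₂ emb
  where
  emb : IsEmbedding S M f
  emb = toWitness {a? = isEmbedding? S M f} q

allCodes? : ∀ k {P : Code k → Set} → (∀ c → Dec (P c)) → Dec (∀ c → P c)
allCodes? zero    P? = map′ (λ p → λ { [] → p }) (λ p → p []) (P? [])
allCodes? (suc k) P? = map′
  (λ p → λ { (vertex true nothing c) → proj₁ (proj₁ (p c)) ; (vertex true (just j) c) → proj₂ (proj₁ (p c)) j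
           ; (vertex false nothing c) → proj₁ (proj₂ (p c)) ; (vertex false (just j) c) → proj₂ (proj₂ (p c)) j })
  (λ p c → (p _ , λ j → p _) , (p _ , λ j → p _))
  (allCodes? k λ c → (P? (vertex true nothing c) ×-dec all? λ j → P? (vertex true (just j) c)) ×-dec
                     (P? (vertex false nothing c) ×-dec all? λ j → P? (vertex false (just j) c)))

-- Edges known to be present; index 0 is x, index i + 1 the i-th vertex of the order.
Facts : ℕ → Set
Facts k = List (Fin (suc k) × Fin (suc k))

Refutable : ∀ k → Facts k → Set
Refutable k facts = ∀ (c : Code k) → T (all (uncurry (adjacency c)) facts) → T (valid c) →
  T (contains Δ122 (adjacency c) ∨ contains T5 (adjacency c) ∨ contains P7⁻ (adjacency c))

refutable? : ∀ k facts → Dec (Refutable k facts)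
refutable? k facts = allCodes? k λ c → T? _ →-dec (T? _ →-dec T? _)

-- From vertices of a frame to codes.

module _ {n} (F : Frame n) where
  open Frame F

  name : ∀ {k} → Vec (Fin n) k → Fin (suc k) → Fin (suc n)
  name vs zero    = x
  name vs (suc i) = punchIn x (lookup vs i)

  -- For an ascending list sparsity leaves at most one candidate, so the choice of witness does not
  -- matter.
  right-of : ∀ {k} → Fin n → Vec (Fin n) k → Maybe (Fin k)
  right-of v vs with any? (λ j → E (lookup vs j) v ≟ᵇ true)
  ... | yes (j , _) = just j
  ... | no _ = nothing

  encode : ∀ {k} → Vec (Fin n) k → Code k
  encode []       = []
  encode (v ∷ vs) = vertex (tour x (punchIn x v)) (right-of v vs) (encode vs)

  private
    Ascending : ∀ {k} → Vec (Fin n) k → Set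
    Ascending = Linked _≺_

    ascending-≺ : ∀ {k v} {vs : Vec (Fin n) k} → Ascending (v ∷ vs) → ∀ j → v ≺ lookup vs j
    ascending-≺ {vs = vs} asc j = lookup⁺ (≺-trans order) {i = zero} {j = suc j} asc z<s

    E-complement : ∀ {u v} → u ≢ v → E u v ≡ not (E v u)
    E-complement u≢v = complement tournament (u≢v ∘ punchIn-injective x _ _)

  ascending-injective : ∀ {k} {vs : Vec (Fin n) k} → Ascending vs → Injective _≡_ _≡_ (lookup vs)
  ascending-injective asc {zero}  {zero}  eq = refl
  ascending-injective {vs = v ∷ vs} asc {zero}  {suc j} eq = contradiction eq (≺⇒≢ order (ascending-≺ asc j))
  ascending-injective {vs = v ∷ vs} asc {suc i} {zero}  eq = contradiction (sym eq) (≺⇒≢ order (ascending-≺ asc i))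
  ascending-injective {vs = v ∷ vs} asc {suc i} {suc j} eq = cong suc (ascending-injective (Linked.tail asc) eq)

  name-injective : ∀ {k} {vs : Vec (Fin n) k} → Ascending vs → Injective _≡_ _≡_ (name vs)
  name-injective asc {zero}  {zero}  eq = refl
  name-injective asc {zero}  {suc j} eq = contradiction (sym eq) (punchInᵢ≢i x _)
  name-injective asc {suc i} {zero}  eq = contradiction eq (punchInᵢ≢i x _)
  name-injective asc {suc i} {suc j} eq = cong suc (ascending-injective asc (punchIn-injective x _ _ eq))

  dominated-encode : ∀ {k} (vs : Vec (Fin n) k) i → dominated (encode vs) i ≡ tour x (punchIn x (lookup vs i))
  dominated-encode (v ∷ vs) zero    = refl
  dominated-encode (v ∷ vs) (suc i) = dominated-encode vs i

  right-of-is : ∀ {k v} {vs : Vec (Fin n) k} → Ascending (v ∷ vs) → ∀ j → right-of v vs is j ≡ E (lookup vs j) v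
  right-of-is {v = v} {vs} asc j with any? (λ j → E (lookup vs j) v ≟ᵇ true)
  ... | no ¬any with E (lookup vs j) v in eq
  ...   | true = contradiction (j , eq) ¬any
  ...   | false = refl
  right-of-is {v = v} {vs} asc j | yes (i , Eiv) with i ≟ j
  ... | yes refl = sym Eiv
  ... | no i≢j with E (lookup vs j) v in eq
  ...   | false = refl
  ...   | true = contradiction (ascending-injective (Linked.tail asc)
            (right-unique sparse (ascending-≺ asc i , Eiv) (ascending-≺ asc j , eq))) i≢j

  edge-encode : ∀ {k} {vs : Vec (Fin n) k} → Ascending vs → ∀ i j → edge (encode vs) i j ≡ E (lookup vs i) (lookup vs j)
  edge-encode {vs = v ∷ vs} asc zero    zero    = sym (IsTournament.irrefl tournament _)
  edge-encode {vs = v ∷ vs} asc zero    (suc j) =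
    trans (cong not (right-of-is asc j)) (sym (E-complement (≺⇒≢ order (ascending-≺ asc j))))
  edge-encode {vs = v ∷ vs} asc (suc i) zero    = right-of-is asc i
  edge-encode {vs = v ∷ vs} asc (suc i) (suc j) = edge-encode (Linked.tail asc) i j

  adjacency-encode : ∀ {k} {vs : Vec (Fin n) k} → Ascending vs →
                     ∀ i j → adjacency (encode vs) i j ≡ tour (name vs i) (name vs j)
  adjacency-encode asc zero    zero    = sym (IsTournament.irrefl tournament x)
  adjacency-encode {vs = vs} asc zero    (suc j) = dominated-encode vs j
  adjacency-encode {vs = vs} asc (suc i) zero    =
    trans (cong not (dominated-encode vs i)) (sym (complement tournament (punchInᵢ≢i x _)))
  adjacency-encode asc (suc i) (suc j) = edge-encode asc i j

  hasLeft-encode : ∀ {k} {vs : Vec (Fin n) k} → Ascending vs →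
                   ∀ j → hasLeft (encode vs) j ≡ true → ∃ λ i → lookup vs i ↩ lookup vs j
  hasLeft-encode {vs = v ∷ vs} asc (suc j) eq with right-of v vs is j in eqj
  ... | true = zero , ascending-≺ asc j , trans (sym (right-of-is asc j)) eqj
  ... | false with hasLeft-encode (Linked.tail asc) j eq
  ...   | i , back = suc i , back

  -- If the vertex with a backedge to `v` had another one to a later vertex of the list,
  -- left-uniqueness would identify `v` with that vertex.
  valid-encode : ∀ {k} {vs : Vec (Fin n) k} → Ascending vs → T (valid (encode vs))
  valid-encode {vs = []}     asc = _
  valid-encode {vs = v ∷ vs} asc = Equivalence.from T-∧ (fresh-encode , valid-encode (Linked.tail asc))
    where
    fresh-encode : T (fresh (right-of v vs) (encode vs))
    fresh-encode with right-of v vs in eqr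
    ... | nothing = _
    ... | just j with hasLeft (encode vs) j in eq
    ...   | false = _
    ...   | true with hasLeft-encode (Linked.tail asc) j eq
    ...     | i , back = contradiction (left-unique sparse (ascending-≺ asc j , Ejv) back) (≺⇒≢ order (ascending-≺ asc i))
      where
      Ejv : E (lookup vs j) v ≡ true
      Ejv = trans (sym (right-of-is asc j)) (trans (cong (_is j) eqr) (dec-true (j ≟ j) refl))

  contains-encode : ∀ {m k} {S : Adj m} {vs : Vec (Fin n) k} → Ascending vs →
                    Free S tour → T (contains S (adjacency (encode vs))) → ⊥
  contains-encode {S = S} {vs} asc free t =
    let f , f-injective , same = contains-sound S (adjacency (encode vs)) t in
    free (name vs ∘ f , f-injective ∘ name-injective asc , λ i j → trans (same i j) (adjacency-encode asc (f i) (f j)))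

  -- The code describes the subtournament on `x` and `vs`, so a forbidden tournament found in the
  -- code lies in `tour`. The implicit argument is settled by evaluation at each use; adjacencies
  -- not fixed by `facts` range over everything that sparsity permits.
  refute : ∀ {k} {vs : Vec (Fin n) k} → Ascending vs → (facts : Facts k) →
           {True (refutable? k facts)} → All (λ (i , j) → tour (name vs i) (name vs j) ≡ true) facts → ⊥
  refute {k} {vs} asc facts {refutable} holds =
    [ contains-encode asc Δ122-free ,
      (λ t → [ contains-encode asc T5-free , contains-encode asc P7⁻-free ]′ (Equivalence.to T-∨ t)) ]′
      (Equivalence.to T-∨ (toWitness refutable (encode vs)
        (all⁻ (uncurry (adjacency (encode vs)))
          (All.map (λ {(i , j)} e → Equivalence.from T-≡ (trans (adjacency-encode asc i j) e)) holds))
        (valid-encode asc)))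

edge-or-back : ∀ {n} {E : Adj n} → IsTournament E → (O : LinearOrder (Fin n)) →
               ∀ {u v} → u ≺[ O ] v → E u v ≡ true ⊎ Back O E u v
edge-or-back tournament O u≺v with IsTournament.total tournament _ _ (≺⇒≢ O u≺v)
... | inj₁ u→v = inj₁ u→v
... | inj₂ v→u = inj₂ (u≺v , v→u)

delete-tournament : ∀ {n} {T : Adj (suc n)} → IsTournament T → ∀ x → IsTournament (delete T x)
delete-tournament tournament x = record
  { irrefl  = λ u → IsTournament.irrefl tournament _
  ; total   = λ u v u≢v → IsTournament.total tournament _ _ (u≢v ∘ punchIn-injective x u v)
  ; antisym = λ u v → IsTournament.antisym tournament _ _
  }

-- Reversal of the edges and the order.

op : ∀ {n} → Adj n → Adj n
op T u v = T v u

op-tournament : ∀ {n} {T : Adj n} → IsTournament T → IsTournament (op T)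
op-tournament tournament = record
  { irrefl  = IsTournament.irrefl tournament
  ; total   = λ u v u≢v → IsTournament.total tournament v u (u≢v ∘ sym)
  ; antisym = λ u v → IsTournament.antisym tournament v u
  }

op-free : ∀ {m n} {S : Adj m} {T : Adj n} → op S Embeds-in S → Free S T → Free S (op T)
op-free (π , π-injective , reversed) free (f , f-injective , same) =
  free (f ∘ π , π-injective ∘ f-injective , λ i j → trans (reversed j i) (same (π j) (π i)))

-- An embedding between tournaments of equal size is an isomorphism. Evaluation finds one for each
-- of the three forbidden tournaments.
self-dual : ∀ {m} (S : Adj m) {_ : T (contains (op S) S)} → op S Embeds-in S
self-dual S {found} = contains-sound (op S) S found

-- Reversing edges and order together preserves backedges while interchanging left with right and
-- `Out` with `In`. Each one-sided lemma below thus yields its mirror image.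
reverse : ∀ {n} → Frame n → Frame n
reverse F = record
  { tour       = op tour
  ; tournament = op-tournament tournament
  ; Δ122-free  = op-free {T = tour} (self-dual Δ122) Δ122-free
  ; T5-free    = op-free {T = tour} (self-dual T5) T5-free
  ; P7⁻-free   = op-free {T = tour} (self-dual P7⁻) P7⁻-free
  ; x          = x
  ; order      = flip order
  ; sparse     = record { left-unique = right-unique sparse ; right-unique = left-unique sparse }
  }
  where open Frame F

-- The two rotations send abc to bca and to cab, respectively: after the exchange
-- that they require, the pair that ends up consecutive is joined by a backedge.
record Stuck {n} (F : Frame n) : Set where
  open Frame F
  field
    exchange     : ∀ {a b} → Out a → In b → ¬ Movable order E a b
    rotate-left  : ∀ {a b c} → Out a → Out b → In c → a ↩ c → b ⋖ c → ¬ Movable order E a b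
    rotate-right : ∀ {a b c} → Out a → In b → In c → a ↩ c → a ⋖ b → ¬ Movable order E b c

open Stuck

-- Reversal interchanges the two rotations and maps the exchange condition to itself.
reverse-stuck : ∀ {n} {F : Frame n} → Stuck F → Stuck (reverse F)
reverse-stuck {F = F} stuck = record
  { exchange     = λ a→x x→b → exchange stuck x→b a→x ∘ movable
  ; rotate-left  = λ a→x b→x x→c back b⋖c → rotate-right stuck x→c b→x a→x back (adjacent b⋖c) ∘ movable
  ; rotate-right = λ a→x x→b x→c back a⋖b → rotate-left stuck x→c x→b a→x back (adjacent a⋖b) ∘ movable
  }
  where
  open Frame F

  adjacent : ∀ {u v} → Adjacent (flip order) u v → v ⋖ u
  adjacent = flip-adjacent {O = flip order}

  movable : ∀ {u v} → Movable (flip order) (op E) u v → Movable order E v u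
  movable (u⋖v , inj₁ back) = adjacent u⋖v , inj₁ back
  movable (u⋖v , inj₂ (¬l , ¬r)) = adjacent u⋖v , inj₂ (¬r , ¬l)

-- Configurations excluded in a stuck order.

module _ {n} (F : Frame n) where
  open Frame F

  -- Decidability turns the failure of `Movable` into an actual backedge taking up the room on the
  -- left of `a` or on the right of `b`.
  blocked : ∀ {a b} → a ⋖ b → ¬ Movable order E a b →
            ¬ (a ↩ b) × ((∃ λ l → l ↩ a) ⊎ (∃ λ r → b ↩ r))
  blocked {a} {b} a⋖b ¬movable = (λ back → ¬movable (a⋖b , inj₁ back)) , neighbour
    where
    neighbour : (∃ λ l → l ↩ a) ⊎ (∃ λ r → b ↩ r)
    neighbour with any? (λ l → back? order E l a) | any? (λ r → back? order E b r)
    ... | yes left | _         = inj₁ left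
    ... | no _     | yes right = inj₂ right
    ... | no ¬left | no ¬right = contradiction (a⋖b , inj₂ (¬left , ¬right)) ¬movable

  out-or-in : ∀ v → Out v ⊎ In v
  out-or-in v = IsTournament.total tournament _ _ (punchInᵢ≢i x v ∘ sym)

  -- The names spell, in order, which vertices are out-neighbours (o) or
  -- in-neighbours (i) of x, with ∗ for those whose adjacency to x is irrelevant.
  module _ {a b c d : Fin n} (ab : a ≺ b) (bc : b ≺ c) (cd : c ≺ d) where

    no-ooii : Out a → Out b → In c → In d → E b c ≡ true → E b a ≡ true → ⊥
    no-ooii x→a x→b c→x d→x b→c b→a = refute F (ab ∷ bc ∷ cd ∷ [-])
      ((0F , 1F) ∷ (0F , 2F) ∷ (3F , 0F) ∷ (4F , 0F) ∷ (2F , 3F) ∷ (2F , 1F) ∷ [])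
      (x→a ∷ x→b ∷ c→x ∷ d→x ∷ b→c ∷ b→a ∷ [])

    no-∗ooi : Out b → Out c → In d → E d a ≡ true → ⊥
    no-∗ooi x→b x→c d→x d→a = refute F (ab ∷ bc ∷ cd ∷ [-])
      ((0F , 2F) ∷ (0F , 3F) ∷ (4F , 0F) ∷ (4F , 1F) ∷ []) (x→b ∷ x→c ∷ d→x ∷ d→a ∷ [])

    no-∗oio : Out b → In c → Out d → E c a ≡ true → E d c ≡ true → ⊥
    no-∗oio x→b c→x x→d c→a d→c = refute F (ab ∷ bc ∷ cd ∷ [-])
      ((0F , 2F) ∷ (3F , 0F) ∷ (0F , 4F) ∷ (3F , 1F) ∷ (4F , 3F) ∷ []) (x→b ∷ c→x ∷ x→d ∷ c→a ∷ d→c ∷ [])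

    no-o∗oi : Out a → Out c → In d → E d a ≡ true → E c b ≡ true → ⊥
    no-o∗oi x→a x→c d→x d→a c→b = refute F (ab ∷ bc ∷ cd ∷ [-])
      ((0F , 1F) ∷ (0F , 3F) ∷ (4F , 0F) ∷ (4F , 1F) ∷ (3F , 2F) ∷ []) (x→a ∷ x→c ∷ d→x ∷ d→a ∷ c→b ∷ [])

    no-i∗oi : In a → Out c → In d → E c a ≡ true → E d b ≡ true → ⊥
    no-i∗oi a→x x→c d→x c→a d→b = refute F (ab ∷ bc ∷ cd ∷ [-])
      ((1F , 0F) ∷ (0F , 3F) ∷ (4F , 0F) ∷ (3F , 1F) ∷ (4F , 2F) ∷ []) (a→x ∷ x→c ∷ d→x ∷ c→a ∷ d→b ∷ [])

    no-∗ioi : In b → Out c → In d → E c a ≡ true → E d b ≡ true → ⊥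
    no-∗ioi b→x x→c d→x c→a d→b = refute F (ab ∷ bc ∷ cd ∷ [-])
      ((2F , 0F) ∷ (0F , 3F) ∷ (4F , 0F) ∷ (3F , 1F) ∷ (4F , 2F) ∷ []) (b→x ∷ x→c ∷ d→x ∷ c→a ∷ d→b ∷ [])

    module _ {e : Fin n} (de : d ≺ e) where

      no-∗ooii : Out b → Out c → In d → In e → E c d ≡ true → E c a ≡ true → ⊥
      no-∗ooii x→b x→c d→x e→x c→d c→a = refute F (ab ∷ bc ∷ cd ∷ de ∷ [-])
        ((0F , 2F) ∷ (0F , 3F) ∷ (4F , 0F) ∷ (5F , 0F) ∷ (3F , 4F) ∷ (3F , 1F) ∷ [])
        (x→b ∷ x→c ∷ d→x ∷ e→x ∷ c→d ∷ c→a ∷ [])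

      no-o∗oii : Out a → Out c → In d → In e → E c d ≡ true → E c b ≡ true → ⊥
      no-o∗oii x→a x→c d→x e→x c→d c→b = refute F (ab ∷ bc ∷ cd ∷ de ∷ [-])
        ((0F , 1F) ∷ (0F , 3F) ∷ (4F , 0F) ∷ (5F , 0F) ∷ (3F , 4F) ∷ (3F , 2F) ∷ [])
        (x→a ∷ x→c ∷ d→x ∷ e→x ∷ c→d ∷ c→b ∷ [])

      no-o∗∗oi : Out a → Out d → In e → E e b ≡ true → E d c ≡ true → ⊥
      no-o∗∗oi x→a x→d e→x e→b d→c = refute F (ab ∷ bc ∷ cd ∷ de ∷ [-])
        ((0F , 1F) ∷ (0F , 4F) ∷ (5F , 0F) ∷ (5F , 2F) ∷ (4F , 3F) ∷ []) (x→a ∷ x→d ∷ e→x ∷ e→b ∷ d→c ∷ [])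

      no-∗∗∗oi : Out d → In e → E d a ≡ true → E e b ≡ true → ⊥
      no-∗∗∗oi x→d e→x d→a e→b = refute F (ab ∷ bc ∷ cd ∷ de ∷ [-])
        ((0F , 4F) ∷ (5F , 0F) ∷ (4F , 1F) ∷ (5F , 2F) ∷ []) (x→d ∷ e→x ∷ d→a ∷ e→b ∷ [])

      -- The suffixes `crossing` and `nested` tell how the two backedges ending at `a` and `b` lie
      -- relative to each other.
      no-∗∗oi∗-crossing : Out c → In d → E c a ≡ true → E d b ≡ true → E e c ≡ true → ⊥
      no-∗∗oi∗-crossing x→c d→x c→a d→b e→c = refute F (ab ∷ bc ∷ cd ∷ de ∷ [-])
        ((0F , 3F) ∷ (4F , 0F) ∷ (3F , 1F) ∷ (4F , 2F) ∷ (5F , 3F) ∷ []) (x→c ∷ d→x ∷ c→a ∷ d→b ∷ e→c ∷ [])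

      no-∗∗oi∗-nested : Out c → In d → E c b ≡ true → E d a ≡ true → E e c ≡ true → ⊥
      no-∗∗oi∗-nested x→c d→x c→b d→a e→c = refute F (ab ∷ bc ∷ cd ∷ de ∷ [-])
        ((0F , 3F) ∷ (4F , 0F) ∷ (3F , 2F) ∷ (4F , 1F) ∷ (5F , 3F) ∷ []) (x→c ∷ d→x ∷ c→b ∷ d→a ∷ e→c ∷ [])

      no-∗∗ooi-crossing : Out c → Out d → In e → E c a ≡ true → E d b ≡ true → E e c ≡ true → ⊥
      no-∗∗ooi-crossing x→c x→d e→x c→a d→b e→c = refute F (ab ∷ bc ∷ cd ∷ de ∷ [-])
        ((0F , 3F) ∷ (0F , 4F) ∷ (5F , 0F) ∷ (3F , 1F) ∷ (4F , 2F) ∷ (5F , 3F) ∷ [])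
        (x→c ∷ x→d ∷ e→x ∷ c→a ∷ d→b ∷ e→c ∷ [])

      no-∗∗ooi-nested : Out c → Out d → In e → E c b ≡ true → E d a ≡ true → E e c ≡ true → ⊥
      no-∗∗ooi-nested x→c x→d e→x c→b d→a e→c = refute F (ab ∷ bc ∷ cd ∷ de ∷ [-])
        ((0F , 3F) ∷ (0F , 4F) ∷ (5F , 0F) ∷ (3F , 2F) ∷ (4F , 1F) ∷ (5F , 3F) ∷ [])
        (x→c ∷ x→d ∷ e→x ∷ c→b ∷ d→a ∷ e→c ∷ [])

  -- Wherever `l` stands relative to `p`, a backedge from `a` to `l` completes an excluded
  -- configuration with `p`, `b`, `q` and `x`.
  descent-left : ∀ {p a b q l} → p ≺ a → a ≺ b → b ≺ q → Out p → Out a → In b → In q →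
                 E a b ≡ true → ¬ (l ↩ a)
  descent-left {p} {l = l} pa ab bq x→p x→a b→x q→x a→b (la , a→l) with compare order l p
  ... | tri< lp _ _ = no-∗ooii lp pa ab bq x→p x→a b→x q→x a→b a→l
  ... | tri≈ _ refl _ = no-ooii pa ab bq x→p x→a b→x q→x a→b a→l
  ... | tri> _ _ pl = no-o∗oii pl la ab bq x→p x→a b→x q→x a→b a→l

  before-adjacent : ∀ {l a b} → a ⋖ b → l ≢ a → l ≺ b → l ≺ a
  before-adjacent a⋖b l≢a l≺b = ⊀⇒≻ order (l≢a ∘ sym) λ a≺l → proj₂ a⋖b _ a≺l l≺b

  after-adjacent : ∀ {a b r} → a ⋖ b → r ≢ b → a ≺ r → b ≺ r
  after-adjacent a⋖b r≢b a≺r = ⊀⇒≻ order r≢b λ r≺b → proj₂ a⋖b _ a≺r r≺b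

  -- Suppose `l ↩ q`. The pair `a`, `q` is blocked by some `q ↩ r`, where `r` is an out-neighbour by
  -- `after`, or by some `k ↩ a`. If `l` precedes `k`, the place of `l` relative to `p` decides. If
  -- `k` precedes `l`, the problem reduces to consecutive `l`, `a`, `q`, whose rotation is blocked
  -- by a third backedge.
  late-in-left : ∀ {p a q l} → Stuck F → p ≺ a → a ⋖ q → Out p → Out a → In q →
                 (∀ {v} → q ≺ v → Out v) → ¬ (l ↩ q)
  late-in-left {p} {a} {q} {l} stuck pa a⋖q@(aq , _) x→p x→a q→x after l↩q@(lq , q→l)
    with blocked a⋖q (exchange stuck x→a q→x)
  ... | ¬a↩q , inj₂ (r , qr , r→q) =
    no-∗oio (before-adjacent a⋖q (λ { refl → ¬a↩q l↩q }) lq) aq qr x→a q→x (after qr) q→l r→q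
  ... | ¬a↩q , inj₁ (k , k↩a@(ka , a→k)) = outer (compare order k l)
    where
    l≢a : l ≢ a
    l≢a refl = ¬a↩q l↩q

    la : l ≺ a
    la = before-adjacent a⋖q l≢a lq

    rotation : k ≺ l → Out l → (∃ λ j → j ↩ l) ⊎ (∃ λ r → a ↩ r) → ⊥
    rotation kl _ (inj₂ (r , a↩r@(ar , r→a))) =
      no-∗∗oi∗-crossing kl la aq (after-adjacent a⋖q (λ { refl → ¬a↩q a↩r }) ar) x→a q→x a→k q→l r→a
    rotation kl x→l (inj₁ (j , j↩l@(jl , l→j))) with compare order j k
    ... | tri< jk _ _ = no-∗∗ooi-crossing jk kl la aq x→l x→a q→x l→j a→k q→l
    ... | tri≈ _ refl _ = l≢a (right-unique sparse j↩l k↩a)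
    ... | tri> _ _ kj = no-∗∗ooi-nested kj jl la aq x→l x→a q→x l→j a→k q→l

    outer : Tri (k ≺ l) (k ≡ l) (l ≺ k) → ⊥
    outer (tri< kl _ _) with out-or-in k | out-or-in l
    -- A vertex between `l` and `a` is excluded, so `l` and `a` are consecutive. As `rotate-left`
    -- forbids exchanging them, there is a further backedge on the left of `l` or on the right of
    -- `a`.
    ... | inj₁ x→k | inj₁ x→l = rotation kl x→l (proj₂ (blocked (la , λ w lw wa → no-∗∗∗oi kl lw wa aq x→a q→x a→k q→l)
                                                  (rotate-left stuck x→l x→a q→x l↩q a⋖q)))
    ... | inj₂ k→x | _ = no-i∗oi kl la aq k→x x→a q→x a→k q→l
    ... | inj₁ _ | inj₂ l→x = no-∗ioi kl la aq l→x x→a q→x a→k q→l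
    outer (tri≈ _ refl _) = ≺⇒≢ order aq (right-unique sparse k↩a l↩q)
    outer (tri> _ _ lk) with compare order l p
    ... | tri< lp _ _ = no-∗ooi lp pa aq x→p x→a q→x q→l
    ... | tri≈ _ refl _ = no-o∗oi lk ka aq x→p x→a q→x q→l a→k
    ... | tri> _ _ pl = no-o∗∗oi pl lk ka aq x→p x→a q→x q→l a→k

  -- The backedges `k ↩ p` and `l ↩ q` would be crossing or nested, as sparsity rules out `k ≡ l`;
  -- both patterns are excluded in the presence of `p ↩ r`.
  crossing-left : ∀ {p q l r k} → p ⋖ q → Out p → In q → ¬ (p ↩ q) → l ↩ q → p ↩ r → ¬ (k ↩ p)
  crossing-left {p} {q} {l} {r} {k} p⋖q@(pq , _) x→p q→x ¬p↩q l↩q@(lq , q→l) p↩r@(pr , r→p) k↩p@(kp , p→k)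
    with before-adjacent p⋖q (λ { refl → ¬p↩q l↩q }) lq | after-adjacent p⋖q (λ { refl → ¬p↩q p↩r }) pr | compare order k l
  ... | lp | qr | tri< kl _ _ = no-∗∗oi∗-crossing kl lp pq qr x→p q→x p→k q→l r→p
  ... | lp | qr | tri≈ _ refl _ = ≺⇒≢ order pq (right-unique sparse k↩p l↩q)
  ... | lp | qr | tri> _ _ lk = no-∗∗oi∗-nested lk kp pq qr x→p q→x p→k q→l r→p

-- Inserting `x` into a sparse order.

module _ {n} (F : Frame n) where
  open Frame F

  out? : Decidable₁ Out
  out? v = tour x (punchIn x v) ≟ᵇ true

  in? : Decidable₁ In
  in? v = tour (punchIn x v) x ≟ᵇ true

  ¬out×in : ∀ {v} → Out v → ¬ In v
  ¬out×in x→v v→x with () ← trans (sym v→x) (IsTournament.antisym tournament _ _ x→v)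

  predecessor : ∀ {u v} → u ≺ v → ∃ λ a → a ⋖ v × ¬ (a ≺ u)
  predecessor {u} {v} u≺v with maximum order (λ w → _≺?_ order w v) (u , u≺v)
  ... | a , a≺v , a-max = a , (a≺v , λ w a≺w w≺v → a-max w w≺v a≺w) , a-max u u≺v

  -- The immediate predecessor `a` of `q` is `u` or comes after `u`, so `u-late` makes it an
  -- out-neighbour. By the choice of `q` all later vertices are out-neighbours, as `late-in-left`
  -- requires.
  last-in-left : ∀ {p q u l} → Stuck F → Out p → In q → (∀ v → In v → ¬ (q ≺ v)) →
                 Out u → p ≺ u → u ≺ q → (∀ v → In v → v ≢ q → ¬ (u ≺ v)) → ¬ (l ↩ q)
  last-in-left {u = u} stuck x→p q→x q-last x→u p≺u u≺q u-late with predecessor u≺q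
  ... | a , a⋖q@(a≺q , _) , a⊀u with out-or-in F a
  ...   | inj₁ x→a = late-in-left F stuck (≺-≼-trans order p≺u a⊀u) a⋖q x→p x→a q→x
            λ {v} q≺v → [ (λ x→v → x→v) , (λ v→x → contradiction q≺v (q-last v v→x)) ]′ (out-or-in F v)
  ...   | inj₂ a→x = contradiction (⊀⇒≻ order (λ { refl → ¬out×in x→u a→x }) a⊀u) (u-late a a→x (≺⇒≢ order a≺q))

  -- Renaming `x` to `nothing` and every other vertex to `just` lets the insertion proceed by
  -- pattern matching.
  original : Maybe (Fin n) → Fin (suc n)
  original nothing  = x
  original (just v) = punchIn x v

  key : Fin (suc n) → Maybe (Fin n)
  key v with x ≟ v
  ... | yes _ = nothing
  ... | no x≢v = just (punchOut x≢v)

  original∘key : ∀ v → original (key v) ≡ v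
  original∘key v with x ≟ v
  ... | yes x≡v = x≡v
  ... | no x≢v = punchIn-punchOut x≢v

  key-injective : Injective _≡_ _≡_ key
  key-injective {u} {v} eq = trans (sym (original∘key u)) (trans (cong original eq) (original∘key v))

  -- A place for `x`, directly after the vertices of `Before`. The backedges at `x` then lead to its
  -- out-neighbours in `Before` and come from its in-neighbours outside. The `only` fields allow one
  -- on each side, and the `free` fields ensure room for it at its other end.
  record Cut : Set₁ where
    field
      Before     : Fin n → Set
      before?    : Decidable₁ Before
      closed     : ∀ {u v} → u ≺ v → Before v → Before u
      left-only  : ∀ {u v} → Before u → Out u → Before v → Out v → u ≡ v
      left-free  : ∀ {u r} → Before u → Out u → ¬ (u ↩ r)
      right-only : ∀ {u v} → ¬ Before u → In u → ¬ Before v → In v → u ≡ v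
      right-free : ∀ {v l} → ¬ Before v → In v → ¬ (l ↩ v)

  module _ (cut : Cut) where
    open Cut cut

    Precedes : Maybe (Fin n) → Maybe (Fin n) → Set
    Precedes (just u) (just v) = u ≺ v
    Precedes (just u) nothing  = Before u
    Precedes nothing  (just v) = ¬ Before v
    Precedes nothing  nothing  = ⊥

    inserted : LinearOrder (Maybe (Fin n))
    inserted = record
      { _≺_ = Precedes
      ; isStrictTotalOrder = isStrictTotalOrderᶜ record
        { isEquivalence = isEquivalence
        ; trans = λ {u} {v} {w} → transitive u v w
        ; compare = trichotomous
        }
      }
      where
      transitive : ∀ u v w → Precedes u v → Precedes v w → Precedes u w
      transitive (just u) (just v) (just w) u≺v v≺w = ≺-trans order u≺v v≺w
      transitive (just u) (just v) nothing  u≺v v-before = closed u≺v v-before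
      transitive (just u) nothing  (just w) u-before w-after with compare order u w
      ... | tri< u≺w _ _ = u≺w
      ... | tri≈ _ refl _ = contradiction u-before w-after
      ... | tri> _ _ w≺u = contradiction (closed w≺u u-before) w-after
      transitive nothing  (just v) (just w) v-after v≺w w-before = v-after (closed v≺w w-before)
      transitive nothing  (just v) nothing  v-after v-before = v-after v-before

      trichotomous : ∀ u v → Tri (Precedes u v) (u ≡ v) (Precedes v u)
      trichotomous (just u) (just v) with compare order u v
      ... | tri< lt ≢ ≯ = tri< lt (λ { refl → ≢ refl }) ≯
      ... | tri≈ ≮ ≡ ≯ = tri≈ ≮ (cong just ≡) ≯
      ... | tri> ≮ ≢ gt = tri> ≮ (λ { refl → ≢ refl }) gt
      trichotomous (just u) nothing with before? u
      ... | yes before = tri< before (λ ()) (λ after → after before)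
      ... | no after = tri> after (λ ()) after
      trichotomous nothing (just v) with before? v
      ... | yes before = tri> (λ after → after before) (λ ()) before
      ... | no after = tri< after (λ ()) after
      trichotomous nothing nothing = tri≈ (λ ()) refl (λ ())

    inserted-sparse : Sparse inserted (λ u v → tour (original u) (original v))
    inserted-sparse = record
      { left-unique = λ {u} {v} {w} → left u v w ; right-unique = λ {u} {v} {w} → right u v w }
      where
      _⇠_ : Maybe (Fin n) → Maybe (Fin n) → Set
      _⇠_ = Back inserted (λ u v → tour (original u) (original v))

      left : ∀ u v w → u ⇠ w → v ⇠ w → u ≡ v
      left (just u) (just v) (just w) p q = cong just (left-unique sparse p q)
      left (just u) (just v) nothing (u-before , x→u) (v-before , x→v) = cong just (left-only u-before x→u v-before x→v)
      left (just u) nothing (just w) p (w-after , w→x) = contradiction p (right-free w-after w→x)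
      left nothing (just v) (just w) (w-after , w→x) q = contradiction q (right-free w-after w→x)
      left nothing nothing w p q = refl
      left (just _) nothing nothing p (() , _)
      left nothing (just _) nothing (() , _) q

      right : ∀ u v w → u ⇠ v → u ⇠ w → v ≡ w
      right (just u) (just v) (just w) p q = cong just (right-unique sparse p q)
      right (just u) (just v) nothing p (u-before , x→u) = contradiction p (left-free u-before x→u)
      right (just u) nothing (just w) (u-before , x→u) q = contradiction q (left-free u-before x→u)
      right nothing (just v) (just w) (v-after , v→x) (w-after , w→x) = cong just (right-only v-after v→x w-after w→x)
      right u nothing nothing p q = refl
      right nothing nothing (just _) (() , _) q
      right nothing (just _) nothing p (() , _)

    cut⇒paving : Paving tour
    cut⇒paving = sparse⇒paving tournament (pullback key key-injective inserted) record
      { left-unique = λ {u} {v} {w} p q → key-injective (left-unique inserted-sparse {key u} {key v} {key w} (relabel p) (relabel q))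
      ; right-unique = λ {u} {v} {w} p q → key-injective (right-unique inserted-sparse {key u} {key v} {key w} (relabel p) (relabel q))
      }
      where
      relabel : ∀ {u v} → Back (pullback key key-injective inserted) tour u v →
                Back inserted (λ u v → tour (original u) (original v)) (key u) (key v)
      relabel {u} {v} (u≺v , v→u) = u≺v , trans (cong₂ tour (original∘key v) (original∘key u)) v→u

-- A stuck order has a place for `x`.

stuck⇒cut : ∀ {n} {F : Frame n} → Stuck F → Cut F
stuck⇒cut {n} {F} stuck
  with any? (λ u → any? λ v → out? F u ×-dec in? F v ×-dec _≺?_ (Frame.order F) u v)
-- Without inversions, `x` fits between its in-neighbours and its out-neighbours and receives no
-- backedge.
... | no sorted = record
  { Before     = In
  ; before?    = in? F
  ; closed     = λ {u} {v} u≺v v→x →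
      [ (λ x→u → contradiction (u , v , x→u , v→x , u≺v) sorted) , (λ u→x → u→x) ]′ (out-or-in F u)
  ; left-only  = λ u→x x→u → contradiction u→x (¬out×in F x→u)
  ; left-free  = λ u→x x→u → contradiction u→x (¬out×in F x→u)
  ; right-only = λ ¬u→x u→x → contradiction u→x ¬u→x
  ; right-free = λ ¬v→x v→x → contradiction v→x ¬v→x
  }
  where open Frame F
-- The first out-neighbour `p` and the last in-neighbour `q` will be the only vertices joined to `x`
-- by backedges.
... | yes (u₀ , v₀ , x→u₀ , v₀→x , u₀≺v₀)
  with minimum (Frame.order F) (out? F) (u₀ , x→u₀) | maximum (Frame.order F) (in? F) (v₀ , v₀→x)
...   | p , x→p , p-first | q , q→x , q-last = cases
  (any? λ l → back? order E l q) (any? λ r → back? order E p r)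
  (any? λ u → out? F u ×-dec ¬? (u ≟ p) ×-dec _≺?_ order u q)
  (any? λ v → in? F v ×-dec ¬? (v ≟ q) ×-dec _≺?_ order p v)
  where
  open Frame F

  p≺q : p ≺ q
  p≺q = ≺-≼-trans order (≼-≺-trans order (p-first u₀ x→u₀) u₀≺v₀) (q-last v₀ v₀→x)

  p≺out : ∀ {u} → Out u → u ≢ p → p ≺ u
  p≺out x→u u≢p = ⊀⇒≻ order u≢p (p-first _ x→u)

  in≺q : ∀ {v} → In v → v ≢ q → v ≺ q
  in≺q v→x v≢q = ⊀⇒≻ order (v≢q ∘ sym) (q-last _ v→x)

  -- From `u` to `v` there is an out-neighbour `a` immediately followed by an in-neighbour `b`. This
  -- pair is blocked, yet `descent-left` and its mirror image rule out the blocking backedge.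
  separated : ∀ {u v} → Out u → u ≢ p → In v → v ≢ q → ¬ (u ≺ v)
  separated {u} {v} x→u u≢p v→x v≢q u≺v
    with minimum order (λ w → in? F w ×-dec _≺?_ order u w) (v , v→x , u≺v)
  ... | b , (b→x , u≺b) , b-min with predecessor F u≺b
  ...   | a , a⋖b@(a≺b , _) , a⊀u with out-or-in F a
  ...     | inj₂ a→x = b-min a (a→x , ⊀⇒≻ order (λ { refl → ¬out×in F x→u a→x }) a⊀u) a≺b
  ...     | inj₁ x→a with blocked F a⋖b (exchange stuck x→a b→x)
  ...       | ¬a↩b , neighbour with edge-or-back (delete-tournament tournament x) order a≺b
  ...         | inj₂ a↩b = ¬a↩b a↩b
  ...         | inj₁ a→b with ≺-≼-trans order (p≺out x→u u≢p) a⊀u | ≼-≺-trans order (b-min v (v→x , u≺v)) (in≺q v→x v≢q)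
  ...           | p≺a | b≺q =
    [ (λ (_ , l↩a) → descent-left F p≺a a≺b b≺q x→p x→a b→x q→x a→b l↩a)
    , (λ (_ , b↩r) → descent-left (reverse F) b≺q a≺b p≺a q→x b→x x→a x→p a→b b↩r) ]′ neighbour

  OutBeforeLast InAfterFirst : Set
  OutBeforeLast = ∃ λ u → Out u × u ≢ p × u ≺ q
  InAfterFirst  = ∃ λ v → In v × v ≢ q × p ≺ v

  last-in-free : OutBeforeLast → ∀ {l} → ¬ (l ↩ q)
  last-in-free (u , x→u , u≢p , u≺q) = last-in-left F stuck x→p q→x q-last x→u (p≺out x→u u≢p) u≺q
    λ v v→x v≢q → separated x→u u≢p v→x v≢q

  first-out-free : InAfterFirst → ∀ {r} → ¬ (p ↩ r)
  first-out-free (v , v→x , v≢q , p≺v) = last-in-left (reverse F) (reverse-stuck stuck) q→x x→p p-first v→x (in≺q v→x v≢q) p≺v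
    λ u x→u u≢p → separated x→u u≢p v→x v≢q

  p⋖q : ¬ OutBeforeLast → ¬ InAfterFirst → p ⋖ q
  p⋖q ¬out ¬in = p≺q , λ w p≺w w≺q →
    [ (λ x→w → ¬out (w , x→w , ≺⇒≢ order p≺w ∘ sym , w≺q))
    , (λ w→x → ¬in (w , w→x , ≺⇒≢ order w≺q , p≺w)) ]′ (out-or-in F w)

  crossing : ∀ {l r} → p ⋖ q → l ↩ q → ¬ (p ↩ r)
  crossing p⋖q l↩q p↩r with blocked F p⋖q (exchange stuck x→p q→x)
  ... | ¬p↩q , inj₁ (_ , k↩p) = crossing-left F p⋖q x→p q→x ¬p↩q l↩q p↩r k↩p
  ... | ¬p↩q , inj₂ (_ , q↩k) = crossing-left (reverse F) (flip-adjacent {O = order} p⋖q) q→x x→p ¬p↩q p↩r l↩q q↩k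

  -- A backedge on the left of `q` prevents placing `x` before `q`; one on the right of `p` prevents
  -- placing `x` after `p`. The first three clauses show that these do not occur together. When just
  -- one occurs, the first or second clause empties `OutBeforeLast` or `InAfterFirst`, which makes
  -- the remaining place an initial segment.
  cases : Dec (∃ λ l → l ↩ q) → Dec (∃ λ r → p ↩ r) → Dec OutBeforeLast → Dec InAfterFirst → Cut F
  cases (yes (_ , l↩q)) _ (yes out) _ = contradiction l↩q (last-in-free out)
  cases _ (yes (_ , p↩r)) _ (yes in′) = contradiction p↩r (first-out-free in′)
  cases (yes (_ , l↩q)) (yes (_ , p↩r)) (no ¬out) (no ¬in) = contradiction p↩r (crossing (p⋖q ¬out ¬in) l↩q)
  -- Here `x` goes between `p` and `q`, with a backedge to each side; `separated` makes `Before` an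
  -- initial segment.
  cases (no ¬l) (no ¬r) _ _ = record
    { Before     = λ v → (In v × v ≢ q) ⊎ v ≡ p
    ; before?    = λ v → (in? F v ×-dec ¬? (v ≟ q)) ⊎-dec (v ≟ p)
    ; closed     = closed
    ; left-only  = λ u-before x→u v-before x→v → trans (out⇒p u-before x→u) (sym (out⇒p v-before x→v))
    ; left-free  = λ u-before x→u u↩r → ¬r (_ , subst (_↩ _) (out⇒p u-before x→u) u↩r)
    ; right-only = λ u-after u→x v-after v→x → trans (in⇒q u-after u→x) (sym (in⇒q v-after v→x))
    ; right-free = λ v-after v→x l↩v → ¬l (_ , subst (_ ↩_) (in⇒q v-after v→x) l↩v)
    }
    where
    closed : ∀ {u v} → u ≺ v → (In v × v ≢ q) ⊎ v ≡ p → (In u × u ≢ q) ⊎ u ≡ p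
    closed {u} {v} u≺v (inj₁ (v→x , v≢q)) with u ≟ p | out-or-in F u
    ... | yes u≡p | _ = inj₂ u≡p
    ... | no u≢p | inj₁ x→u = contradiction u≺v (separated x→u u≢p v→x v≢q)
    ... | no u≢p | inj₂ u→x = inj₁ (u→x , λ { refl → q-last _ v→x u≺v })
    closed {u} {v} u≺v (inj₂ refl) with out-or-in F u
    ... | inj₁ x→u = contradiction u≺v (p-first _ x→u)
    ... | inj₂ u→x = inj₁ (u→x , λ { refl → asym order u≺v p≺q })

    out⇒p : ∀ {v} → (In v × v ≢ q) ⊎ v ≡ p → Out v → v ≡ p
    out⇒p (inj₁ (v→x , _)) x→v = contradiction v→x (¬out×in F x→v)
    out⇒p (inj₂ v≡p) _ = v≡p

    in⇒q : ∀ {v} → ¬ ((In v × v ≢ q) ⊎ v ≡ p) → In v → v ≡ q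
    in⇒q {v} v-after v→x with v ≟ q
    ... | yes v≡q = v≡q
    ... | no v≢q = contradiction (inj₁ (v→x , v≢q)) v-after
  -- Here `x` follows all its in-neighbours, including `q`, and its only backedge joins it to `p`.
  cases (yes _) (no ¬r) (no ¬out) _ = record
    { Before     = λ v → In v ⊎ v ≡ p
    ; before?    = λ v → in? F v ⊎-dec (v ≟ p)
    ; closed     = closed
    ; left-only  = λ u-before x→u v-before x→v → trans (out⇒p u-before x→u) (sym (out⇒p v-before x→v))
    ; left-free  = λ u-before x→u u↩r → ¬r (_ , subst (_↩ _) (out⇒p u-before x→u) u↩r)
    ; right-only = λ u-after u→x → contradiction (inj₁ u→x) u-after
    ; right-free = λ v-after v→x → contradiction (inj₁ v→x) v-after
    }
    where
    closed : ∀ {u v} → u ≺ v → In v ⊎ v ≡ p → In u ⊎ u ≡ p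
    closed {u} {v} u≺v v-before with u ≟ p | out-or-in F u
    ... | yes u≡p | _ = inj₂ u≡p
    ... | no _ | inj₂ u→x = inj₁ u→x
    ... | no u≢p | inj₁ x→u with v-before
    ...   | inj₁ v→x = contradiction (u , x→u , u≢p , ≺-≼-trans order u≺v (q-last v v→x)) ¬out
    ...   | inj₂ refl = contradiction u≺v (p-first _ x→u)

    out⇒p : ∀ {v} → In v ⊎ v ≡ p → Out v → v ≡ p
    out⇒p (inj₁ v→x) x→v = contradiction v→x (¬out×in F x→v)
    out⇒p (inj₂ v≡p) _ = v≡p
  -- Here `x` precedes all its out-neighbours, including `p`, and its only backedge joins it to `q`.
  cases (no ¬l) (yes _) _ (no ¬in) = record
    { Before     = λ v → In v × v ≢ q
    ; before?    = λ v → in? F v ×-dec ¬? (v ≟ q)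
    ; closed     = closed
    ; left-only  = λ (u→x , _) x→u → contradiction u→x (¬out×in F x→u)
    ; left-free  = λ (u→x , _) x→u → contradiction u→x (¬out×in F x→u)
    ; right-only = λ u-after u→x v-after v→x → trans (in⇒q u-after u→x) (sym (in⇒q v-after v→x))
    ; right-free = λ v-after v→x l↩v → ¬l (_ , subst (_ ↩_) (in⇒q v-after v→x) l↩v)
    }
    where
    closed : ∀ {u v} → u ≺ v → In v × v ≢ q → In u × u ≢ q
    closed {u} {v} u≺v (v→x , v≢q) with out-or-in F u
    ... | inj₁ x→u = contradiction (v , v→x , v≢q , ≼-≺-trans order (p-first u x→u) u≺v) ¬in
    ... | inj₂ u→x = u→x , λ { refl → q-last _ v→x u≺v }

    in⇒q : ∀ {v} → ¬ (In v × v ≢ q) → In v → v ≡ q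
    in⇒q {v} v-after v→x with v ≟ q
    ... | yes v≡q = v≡q
    ... | no v≢q = contradiction (v→x , v≢q) v-after

-- Descent on the number of inversions.

swap-adjacentˡ : ∀ {n} (O : LinearOrder (Fin n)) {a b c} → Adjacent O a b → Adjacent O b c → Adjacent (swap a b O) a c
swap-adjacentˡ O {a} {b} {c} a⋖b@(a≺b , a-b) (b≺c , b-c) = ⊀⇒≻ O′ {c} {a} (λ { refl → asym O a≺b b≺c }) c⊀a , between
  where
  O′ = swap a b O

  c⊀a : ¬ (c ≺[ O′ ] a)
  c⊀a c≺a with swap-≺ O a⋖b {c} {a} c≺a
  ... | inj₁ c≺a = asym O c≺a (≺-trans O a≺b b≺c)
  ... | inj₂ (refl , _) = irrefl O refl b≺c

  between : ∀ w → a ≺[ O′ ] w → w ≺[ O′ ] c → ⊥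
  between w a≺w w≺c with swap-≺ O a⋖b {a} {w} a≺w | swap-≺ O a⋖b {w} {c} w≺c
  ... | inj₂ (refl , _) | _ = irrefl O refl a≺b
  ... | inj₁ _ | inj₂ (_ , refl) = asym O a≺b b≺c
  ... | inj₁ a≺w′ | inj₁ w≺c′ with compare O w b
  ...   | tri< w≺b _ _ = a-b w a≺w′ w≺b
  ...   | tri≈ _ refl _ = asym O′ {a} {w} a≺w (swapped O a⋖b)
  ...   | tri> _ _ b≺w = b-c w b≺w w≺c′

swap-adjacentʳ : ∀ {n} (O : LinearOrder (Fin n)) {a b c} → Adjacent O a b → Adjacent O b c → Adjacent (swap b c O) a c
swap-adjacentʳ O {a} {b} {c} (a≺b , a-b) b⋖c@(b≺c , b-c) = ⊀⇒≻ O′ {c} {a} (λ { refl → asym O a≺b b≺c }) c⊀a , between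
  where
  O′ = swap b c O

  c⊀a : ¬ (c ≺[ O′ ] a)
  c⊀a c≺a with swap-≺ O b⋖c {c} {a} c≺a
  ... | inj₁ c≺a = asym O c≺a (≺-trans O a≺b b≺c)
  ... | inj₂ (_ , refl) = irrefl O refl a≺b

  between : ∀ w → a ≺[ O′ ] w → w ≺[ O′ ] c → ⊥
  between w a≺w w≺c with swap-≺ O b⋖c {a} {w} a≺w | swap-≺ O b⋖c {w} {c} w≺c
  ... | inj₂ (refl , _) | _ = asym O a≺b b≺c
  ... | inj₁ _ | inj₂ (_ , refl) = irrefl O refl b≺c
  ... | inj₁ a≺w′ | inj₁ w≺c′ with compare O w b
  ...   | tri< w≺b _ _ = a-b w a≺w′ w≺b
  ...   | tri≈ _ refl _ = asym O′ {w} {c} w≺c (swapped O b⋖c)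
  ...   | tri> _ _ b≺w = b-c w b≺w w≺c′

Inverted : ∀ {n} → Frame n → Fin n → Fin n → Set
Inverted F u v = u ≺ v × Out u × In v
  where open Frame F

inverted? : ∀ {n} (F : Frame n) → Decidable (Inverted F)
inverted? F u v = _≺?_ (Frame.order F) u v ×-dec out? F u ×-dec in? F v

module _ {n} (F : Frame n) {a b : Fin n} where
  open Frame F

  exchanged : Movable order E a b → Frame n
  exchanged movable = record F
    { order  = swap a b order
    ; sparse = swap-sparse order (proj₁ movable) (IsTournament.antisym tournament _ _) sparse movable
    }

  module _ (movable : Movable order E a b) where

    -- The only new comparison puts `b` before `a`, so exchanging two out-neighbours or two
    -- in-neighbours creates no inversion either.
    exchanged-⊆ : ¬ (Out b × In a) → ∀ {u v} → Inverted (exchanged movable) u v → Inverted F u v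
    exchanged-⊆ ¬inverted {u} {v} (u≺v , x→u , v→x) with swap-≺ order (proj₁ movable) {u} {v} u≺v
    ... | inj₁ u≺v = u≺v , x→u , v→x
    ... | inj₂ (refl , refl) = contradiction (x→u , v→x) ¬inverted

    exchanged-∌ : ¬ Inverted (exchanged movable) a b
    exchanged-∌ (a≺b , _) = asym (swap a b order) {a} {b} a≺b (swapped order (proj₁ movable))

-- Well-founded recursion takes the place of choosing a minimum: an available move leads to a frame
-- with fewer inversions, and if there is none the order is stuck.
frame⇒paving : ∀ {n} (F : Frame n) → Acc _<_ (count (inverted? F)) → Paving (Frame.tour F)
frame⇒paving F (acc rec)
  with any? (λ a → any? λ b → out? F a ×-dec in? F b ×-dec movable? order E a b)
     | any? (λ a → any? λ b → any? λ c → out? F a ×-dec out? F b ×-dec in? F c ×-dec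
                     back? order E a c ×-dec adjacent? order b c ×-dec movable? order E a b)
     | any? (λ a → any? λ b → any? λ c → out? F a ×-dec in? F b ×-dec in? F c ×-dec
                     back? order E a c ×-dec adjacent? order a b ×-dec movable? order E b c)
  where open Frame F
... | yes (a , b , x→a , b→x , movable) | _ | _ =
  frame⇒paving (exchanged F movable) (rec (count-strict (inverted? (exchanged F movable)) (inverted? F)
    (exchanged-⊆ F movable λ (_ , a→x) → ¬out×in F x→a a→x)
    (proj₁ (proj₁ movable) , x→a , b→x) (exchanged-∌ F movable)))
-- The first exchange concerns two out-neighbours and adds no inversion; the second one removes the
-- inversion of `a` and `c`.
... | no _ | yes (a , b , c , x→a , x→b , c→x , (a≺c , c→a) , b⋖c , movable) | _ =
  frame⇒paving (exchanged F₁ movable₁) (rec (count-strict (inverted? (exchanged F₁ movable₁)) (inverted? F)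
    (exchanged-⊆ F movable (λ (_ , a→x) → ¬out×in F x→a a→x) ∘
     exchanged-⊆ F₁ movable₁ (λ (_ , a→x) → ¬out×in F x→a a→x))
    (a≺c , x→a , c→x) (exchanged-∌ F₁ movable₁)))
  where
  F₁ = exchanged F movable
  a⋖c = swap-adjacentˡ (Frame.order F) (proj₁ movable) b⋖c

  movable₁ : Movable (Frame.order F₁) (Frame.E F₁) a c
  -- The first exchange has made `a` and `c` consecutive, and the backedge from `c` to `a` is still
  -- there, so the second exchange is permitted.
  movable₁ = a⋖c , inj₁ (proj₁ a⋖c , c→a)
... | no _ | no _ | yes (a , b , c , x→a , b→x , c→x , (a≺c , c→a) , a⋖b , movable) =
  frame⇒paving (exchanged F₁ movable₁) (rec (count-strict (inverted? (exchanged F₁ movable₁)) (inverted? F)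
    (exchanged-⊆ F movable (λ (x→c , _) → ¬out×in F x→c c→x) ∘
     exchanged-⊆ F₁ movable₁ (λ (x→c , _) → ¬out×in F x→c c→x))
    (a≺c , x→a , c→x) (exchanged-∌ F₁ movable₁)))
  where
  F₁ = exchanged F movable
  a⋖c = swap-adjacentʳ (Frame.order F) a⋖b (proj₁ movable)

  movable₁ : Movable (Frame.order F₁) (Frame.E F₁) a c
  movable₁ = a⋖c , inj₁ (proj₁ a⋖c , c→a)
... | no ¬exchange | no ¬left | no ¬right = cut⇒paving F (stuck⇒cut record
  { exchange     = λ x→a b→x movable → ¬exchange (_ , _ , x→a , b→x , movable)
  ; rotate-left  = λ x→a x→b c→x back b⋖c movable → ¬left (_ , _ , _ , x→a , x→b , c→x , back , b⋖c , movable)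
  ; rotate-right = λ x→a b→x c→x back a⋖b movable → ¬right (_ , _ , _ , x→a , b→x , c→x , back , a⋖b , movable)
  })

-- The initial sparse order and the theorem.

paving⇒sparse : ∀ {n} {E : Adj n} → Paving E → Σ (LinearOrder (Fin n)) λ O → Sparse O E
paving⇒sparse {n} {E} (σ , _ , lefts , rights) = O , record
  { left-unique  = λ {u} {v} {w} p q →
      position-injective (lefts (position w) (position u) (position v) (proj₁ p) (proj₁ q) (backedge p) (backedge q))
  ; right-unique = λ {u} {v} {w} p q →
      position-injective (rights (position u) (position v) (position w) (proj₁ p) (proj₁ q) (backedge′ p) (backedge′ q))
  }
  where
  position : Fin n → Fin n
  position = σ ⟨$⟩ˡ_

  position-injective : Injective _≡_ _≡_ position
  position-injective eq = trans (sym (inverseʳ σ)) (trans (cong (σ ⟨$⟩ʳ_) eq) (inverseʳ σ))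

  O : LinearOrder (Fin n)
  -- Vertices are compared by position, hence through the inverse of `σ`.
  O = pullback position position-injective record { _≺_ = Fin._<_ ; isStrictTotalOrder = <-isStrictTotalOrder }

  backedge : ∀ {u v} → Back O E u v → Backedge E σ (position v) (position u)
  backedge (u<v , v→u) = inj₁ (u<v , trans (cong₂ E (inverseʳ σ) (inverseʳ σ)) v→u)

  backedge′ : ∀ {u v} → Back O E u v → Backedge E σ (position u) (position v)
  backedge′ back = [ inj₂ , inj₁ ]′ (backedge back)

theorem5p1 : ∀ (n : ℕ) (T : Adj (suc n)) → IsTournament T → suc n ≥ 5 →
    Free Δ122 T → Free T5 T → Free P7⁻ T →
    (x : Fin (suc n)) → Paving (delete T x) →
    (∃ λ a → ∃ λ b → a ≢ b × T a x ≡ true × T b x ≡ true) →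
    (∃ λ a → ∃ λ b → a ≢ b × T x a ≡ true × T x b ≡ true) →
    Paving T
theorem5p1 n T tournament _ Δ122-free T5-free P7⁻-free x paving _ _ =
  let O , sparse = paving⇒sparse paving in
  frame⇒paving record
    { tour = T ; tournament = tournament ; Δ122-free = Δ122-free ; T5-free = T5-free ; P7⁻-free = P7⁻-free
    ; x = x ; order = O ; sparse = sparse }
    (<-wellFounded _)
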